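{- There is a quiescently terminating content-oblivious algorithm of message complexity $n(2\cdot \mathrm{ID}_{\max}+1)$ that elects a leader in oriented rings of $n$ nodes with unique IDs, where $\mathrm{ID}_{\max}$ is the largest ID assigned to a node.
   Context: Content-oblivious model: a ring of $n$ nodes, each node having two ports (Port 0 and Port 1), each connected by a bidirectional channel to one of its two neighbours. All messages are fully corrupted, so a message is a content-free "pulse". The network is asynchronous: every pulse is delivered after an arbitrary but finite delay; pulses are never lost or injected. Nodes are event-driven: a node may act once at the start and afterwards only when it processes a received pulse; its actions (changing state, sending any number of pulses on each port) depend only on its own ID and the sequence of pulses it has received so far (with the port each arrived on). Algorithms are uniform: nodes do not know $n$ or any bound on it. Each node $v$ has a unique ID $\mathrm{ID}(v)\in\mathbb{N}$; $\mathrm{ID}_{\max}=\max_v \mathrm{ID}(v)$. The ring is oriented: if every node forwards a pulse received on one port out of its Port 1, the pulse travels through all edges of the ring (Port 1 is the clockwise port). Leader election: every node must terminate with output Leader or Non-Leader, exactly one node outputting Leader. Termination: each node eventually decides its output and enters a terminating state, after which it ignores incoming pulses and sends none. Quiescent termination: additionally, when the last node terminates, no pulses are in transit. Message complexity: total number of pulses sent in a worst-case execution. -}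

module Defs where

open import Data.Nat using (ℕ; zero; suc; _+_; _*_; _∸_; _⊔_; _≤_; _<_)
open import Data.Nat.DivMod using (_mod_)
open import Data.Fin using (Fin; toℕ) renaming (zero to fzero; suc to fsuc)
import Data.Fin as Fin
open import Data.Bool using (Bool; true; false; if_then_else_)
open import Data.List using (List; []; _∷_)
open import Data.Maybe using (Maybe; just; nothing)
open import Data.Product using (Σ; _×_; _,_)
open import Relation.Nullary using (¬_; does)
open import Relation.Binary.PropositionalEquality using (_≡_; _≢_)
open import Function.Definitions using (Injective)

-- Ports of a node.  Port 1 is the clockwise port.
data Port : Set where
  port0 port1 : Port

samePort : Port → Port → Bool
samePort port0 port0 = true
samePort port1 port1 = true
samePort _ _ = false

data Output : Set where
  Leader NonLeader : Output

-- What a node does in one atomic step: send some number of pulses on each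
-- port, and possibly decide an output (which makes the node terminate).
record Action : Set where
  field
    send₀    : ℕ
    send₁    : ℕ
    decision : Maybe Output
open Action public

-- A (uniform) content-oblivious algorithm: the behaviour of a node depends
-- only on its ID and on the sequence of pulses it has received so far
-- (the port each arrived on; the list is newest-first and INCLUDES the pulse
-- currently being processed).  It does not depend on n.
record Algorithm : Set where
  field
    start   : ℕ → Action
    onPulse : ℕ → List Port → Action
open Algorithm public

-- Oriented ring of N = suc m nodes 0..m.  Port 1 of node i is connected to
-- Port 0 of node i+1 (mod N).
next : ∀ {m} → Fin (suc m) → Fin (suc m)
next {m} i = (suc (toℕ i)) mod (suc m)

prev : ∀ {m} → Fin (suc m) → Fin (suc m)
prev {m} i = (toℕ i + m) mod (suc m)

sumF : ∀ {n} → (Fin n → ℕ) → ℕ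
sumF {zero}  f = 0
sumF {suc n} f = f fzero + sumF (λ i → f (fsuc i))

maxF : ∀ {m} → (Fin (suc m) → ℕ) → ℕ
maxF {zero}  f = f fzero
maxF {suc m} f = f fzero ⊔ maxF (λ i → f (fsuc i))

record Config (m : ℕ) : Set where
  field
    hist    : Fin (suc m) → List Port         -- pulses received (newest first)
    out     : Fin (suc m) → Maybe Output      -- nothing = not yet terminated
    transit : Fin (suc m) → Port → ℕ          -- pulses in transit to (node, port)
    sent    : ℕ
open Config public

module Execution (A : Algorithm) (m : ℕ) (ID : Fin (suc m) → ℕ) where

  Node = Fin (suc m)

  addSends : Node → Action → (Node → Port → ℕ) → Node → Port → ℕ
  addSends i a t j port0 = t j port0 + (if does (j Fin.≟ next i) then send₁ a else 0)
  addSends i a t j port1 = t j port1 + (if does (j Fin.≟ prev i) then send₀ a else 0)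

  consume : Node → Port → (Node → Port → ℕ) → Node → Port → ℕ
  consume i p t j q = if does (j Fin.≟ i) then (if samePort p q then t j q ∸ 1 else t j q) else t j q

  initial : Config m
  initial = record
    { hist    = λ _ → []
    ; out     = λ i → decision (start A (ID i))
    ; transit = λ { j port0 → send₁ (start A (ID (prev j)))
                  ; j port1 → send₀ (start A (ID (next j))) }
    ; sent    = sumF (λ i → send₀ (start A (ID i)) + send₁ (start A (ID i)))
    }

  deliver : Config m → Node → Port → Config m
  deliver c i p with out c i
  ... | just _  = record c { transit = consume i p (transit c) }
  ... | nothing =
    let h = p ∷ hist c i
        a = onPulse A (ID i) h
    in record
      { hist    = λ j → if does (j Fin.≟ i) then h else hist c j
      ; out     = λ j → if does (j Fin.≟ i) then decision a else out c j
      ; transit = addSends i a (consume i p (transit c))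
      ; sent    = sent c + send₀ a + send₁ a
      }

  data Reachable : Config m → Set where
    init : Reachable initial
    step : ∀ {c} → Reachable c → (i : Node) (p : Port) →
           0 < transit c i p → Reachable (deliver c i p)

  NoTransit : Config m → Set
  NoTransit c = ∀ i p → transit c i p ≡ 0

  AllTerminated : Config m → Set
  AllTerminated c = ∀ i → ¬ (out c i ≡ nothing)

  ExactlyOneLeader : Config m → Set
  ExactlyOneLeader c = Σ Node λ ℓ →
    (out c ℓ ≡ just Leader) × (∀ j → j ≢ ℓ → out c j ≡ just NonLeader)

QuiescentLEWithComplexity : Algorithm → Set
QuiescentLEWithComplexity A =
  ∀ (m : ℕ) (ID : Fin (suc m) → ℕ) → Injective _≡_ _≡_ ID →
  let open Execution A m ID in
    (∀ c → Reachable c → sent c ≤ suc m * (2 * maxF ID + 1))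
  × (∀ c → Reachable c → AllTerminated c → NoTransit c)
    -- every maximal (hence finished) execution ends with all nodes terminated
    -- and exactly one Leader
  × (∀ c → Reachable c → NoTransit c → ExactlyOneLeader c)

{-# OPTIONS --safe #-}
module Submission where

-- Every node first relays clockwise pulses, absorbing one when its clockwise
-- count equals its ID, so that every clockwise count ends at M = IDmax.  Once
-- its clockwise count has reached its ID, a node does the same
-- counterclockwise.  A node whose two counts both equal its ID is a candidate
-- and emits one extra counterclockwise pulse; a node stops when its
-- counterclockwise count exceeds its clockwise count.
--
-- Follow the ring clockwise from a node with counts A ≤ B: as long as the
-- counterclockwise count stays ≥ B the nodes are started and their clockwise
-- count stays ≤ A; if this goes all the way round, the node of ID M gives
-- A = M.  If all IDs are positive, only the node of ID M becomes a candidate;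
-- but a node of ID 0 is a candidate from the start, and its extra pulse can
-- mislead ID 1 behind it, which can mislead ID 2 behind it, and so on.  The
-- misled candidates form a run k, k-1, …, 0 of consecutive nodes.  This is
-- harmless when k < M: the node behind the run has an ID above k, so it does not relay
-- counterclockwise pulses before its clockwise count exceeds k.

open import Defs
open import Data.Bool using (if_then_else_)
open import Data.Fin using (Fin; toℕ) renaming (zero to fzero; suc to fsuc)
import Data.Fin as Fin
open import Data.Fin.Properties using (toℕ-injective; toℕ-fromℕ<; toℕ<n)
  renaming (suc-injective to fsuc-injective)
open import Data.List using (List; []; _∷_)
open import Data.Maybe using (Maybe; just; nothing)
open import Data.Nat
open import Data.Nat.DivMod using (_mod_; %-distribˡ-+; m%n%n≡m%n; m%n<n; m<n⇒m%n≡m; [m+kn]%n≡m%n; [m+n]%n≡m%n)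
open import Data.Nat.Properties
open import Algebra.Properties.CommutativeSemigroup +-commutativeSemigroup
  using (xy∙z≈xz∙y; interchange)
open import Data.Product using (Σ; ∃; _×_; _,_; proj₁; proj₂)
open import Data.Sum using (_⊎_; inj₁; inj₂)
open import Function using (_∘_; Injective)
open import Relation.Nullary using (Dec; yes; no; ¬_; does; contradiction)
open import Relation.Nullary.Decidable using (dec-true; dec-false; _×-dec_; _⊎-dec_)
open import Relation.Binary.Definitions using (tri<; tri≈; tri>)
open import Relation.Binary.PropositionalEquality

-- Cyclic order

toℕ-mod : ∀ k m → toℕ (k mod suc m) ≡ k % suc m
toℕ-mod k m = toℕ-fromℕ< (m%n<n k (suc m))

[m%n+k]%n≡[m+k]%n : ∀ m k n .{{_ : NonZero n}} → (m % n + k) % n ≡ (m + k) % n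
[m%n+k]%n≡[m+k]%n m k n = begin
  (m % n + k) % n          ≡⟨ %-distribˡ-+ (m % n) k n ⟩
  (m % n % n + k % n) % n  ≡⟨ cong (λ x → (x + k % n) % n) (m%n%n≡m%n m n) ⟩
  (m % n + k % n) % n      ≡⟨ %-distribˡ-+ m k n ⟨
  (m + k) % n              ∎
  where open ≡-Reasoning

module _ {m : ℕ} where

  private N = suc m

  toℕ-% : (i : Fin N) → toℕ i % N ≡ toℕ i
  toℕ-% i = m<n⇒m%n≡m (toℕ<n i)

  toℕ-next : (i : Fin N) → toℕ (next i) ≡ (toℕ i + 1) % N
  toℕ-next i = trans (toℕ-mod (suc (toℕ i)) m) (cong (_% N) (+-comm 1 (toℕ i)))

  toℕ-prev : (i : Fin N) → toℕ (prev i) ≡ (toℕ i + m) % N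
  toℕ-prev i = toℕ-mod (toℕ i + m) m

  full-turn : ∀ (i : Fin N) j k → j + k ≡ N → ((toℕ i + j) % N + k) % N ≡ toℕ i
  full-turn i j k eq = begin
    ((toℕ i + j) % N + k) % N ≡⟨ [m%n+k]%n≡[m+k]%n (toℕ i + j) k N ⟩
    (toℕ i + j + k) % N       ≡⟨ cong (_% N) (+-assoc (toℕ i) j k) ⟩
    (toℕ i + (j + k)) % N     ≡⟨ cong (λ x → (toℕ i + x) % N) eq ⟩
    (toℕ i + N) % N           ≡⟨ [m+n]%n≡m%n (toℕ i) N ⟩
    toℕ i % N                 ≡⟨ toℕ-% i ⟩
    toℕ i                     ∎
    where open ≡-Reasoning

  next-prev : (i : Fin N) → next (prev i) ≡ i
  next-prev i = toℕ-injective (begin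
    toℕ (next (prev i))       ≡⟨ toℕ-next (prev i) ⟩
    (toℕ (prev i) + 1) % N    ≡⟨ cong (λ x → (x + 1) % N) (toℕ-prev i) ⟩
    ((toℕ i + m) % N + 1) % N ≡⟨ full-turn i m 1 (+-comm m 1) ⟩
    toℕ i                     ∎)
    where open ≡-Reasoning

  prev-next : (i : Fin N) → prev (next i) ≡ i
  prev-next i = toℕ-injective (begin
    toℕ (prev (next i))       ≡⟨ toℕ-prev (next i) ⟩
    (toℕ (next i) + m) % N    ≡⟨ cong (λ x → (x + m) % N) (toℕ-next i) ⟩
    ((toℕ i + 1) % N + m) % N ≡⟨ full-turn i 1 m refl ⟩
    toℕ i                     ∎)
    where open ≡-Reasoning

  next-closed : ∀ {ℓ} (P : Fin N → Set ℓ) → (∀ i → P i → P (next i)) →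
                ∀ {i} → P i → ∀ j → P j
  next-closed P closed {i} Pi j =
    -- The step count `toℕ i * m + toℕ j` avoids subtraction: added to `toℕ i` it gives
    -- `toℕ i * N + toℕ j`, which is `toℕ j` modulo `N`.
    subst P (toℕ-injective target) (turn (toℕ i * m + toℕ j))
    where
    open ≡-Reasoning
    turn : ∀ k → P ((toℕ i + k) mod N)
    turn zero = subst P (toℕ-injective (sym (begin
      toℕ ((toℕ i + 0) mod N) ≡⟨ toℕ-mod (toℕ i + 0) m ⟩
      (toℕ i + 0) % N         ≡⟨ cong (_% N) (+-identityʳ (toℕ i)) ⟩
      toℕ i % N               ≡⟨ toℕ-% i ⟩
      toℕ i                   ∎))) Pi
    turn (suc k) = subst P (toℕ-injective (begin
      toℕ (next ((toℕ i + k) mod N))     ≡⟨ toℕ-next ((toℕ i + k) mod N) ⟩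
      (toℕ ((toℕ i + k) mod N) + 1) % N  ≡⟨ cong (λ x → (x + 1) % N) (toℕ-mod (toℕ i + k) m) ⟩
      ((toℕ i + k) % N + 1) % N          ≡⟨ [m%n+k]%n≡[m+k]%n (toℕ i + k) 1 N ⟩
      (toℕ i + k + 1) % N                ≡⟨ cong (_% N) (trans (+-comm _ 1) (sym (+-suc (toℕ i) k))) ⟩
      (toℕ i + suc k) % N                ≡⟨ toℕ-mod (toℕ i + suc k) m ⟨
      toℕ ((toℕ i + suc k) mod N)        ∎)) (closed _ (turn k))
    target : toℕ ((toℕ i + (toℕ i * m + toℕ j)) mod N) ≡ toℕ j
    target = begin
      toℕ ((toℕ i + (toℕ i * m + toℕ j)) mod N) ≡⟨ toℕ-mod (toℕ i + (toℕ i * m + toℕ j)) m ⟩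
      (toℕ i + (toℕ i * m + toℕ j)) % N  ≡⟨ cong (_% N) (+-assoc (toℕ i) _ _) ⟨
      (toℕ i + toℕ i * m + toℕ j) % N    ≡⟨ cong (λ x → (x + toℕ j) % N) (*-suc (toℕ i) m) ⟨
      (toℕ i * N + toℕ j) % N            ≡⟨ cong (_% N) (+-comm (toℕ i * N) (toℕ j)) ⟩
      (toℕ j + toℕ i * N) % N            ≡⟨ [m+kn]%n≡m%n (toℕ j) (toℕ i) N ⟩
      toℕ j % N                          ≡⟨ toℕ-% j ⟩
      toℕ j                              ∎

-- Finite maxima and sums

f≤maxF : ∀ {m} (f : Fin (suc m) → ℕ) i → f i ≤ maxF f
f≤maxF {zero}  f fzero    = ≤-refl
f≤maxF {suc m} f fzero    = m≤m⊔n _ _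
f≤maxF {suc m} f (fsuc i) = ≤-trans (f≤maxF (f ∘ fsuc) i) (m≤n⊔m (f fzero) _)

maxF-attained : ∀ {m} (f : Fin (suc m) → ℕ) → ∃ λ i → f i ≡ maxF f
maxF-attained {zero}  f = fzero , refl
maxF-attained {suc m} f with maxF-attained (f ∘ fsuc) | ⊔-sel (f fzero) (maxF (f ∘ fsuc))
... | _      | inj₁ eq = fzero , sym eq
... | i , fi | inj₂ eq = fsuc i , trans fi (sym eq)

sumF-cong : ∀ {n} {f g : Fin n → ℕ} → (∀ i → f i ≡ g i) → sumF f ≡ sumF g
sumF-cong {zero}  eq = refl
sumF-cong {suc n} eq = cong₂ _+_ (eq fzero) (sumF-cong (eq ∘ fsuc))

sumF-≤ : ∀ {n} {f : Fin n → ℕ} {k} → (∀ i → f i ≤ k) → sumF f ≤ n * k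
sumF-≤ {zero}  f≤k = z≤n
sumF-≤ {suc n} f≤k = +-mono-≤ (f≤k fzero) (sumF-≤ (f≤k ∘ fsuc))

sumF-update : ∀ {n} {f g : Fin n → ℕ} {d} i → g i ≡ f i + d →
              (∀ j → j ≢ i → g j ≡ f j) → sumF g ≡ sumF f + d
sumF-update {f = f} {d = d} fzero at off =
  trans (cong₂ _+_ at (sumF-cong (λ j → off (fsuc j) λ ())))
        (xy∙z≈xz∙y (f fzero) d _)
sumF-update {f = f} (fsuc i) at off =
  trans (cong₂ _+_ (off fzero λ ())
                   (sumF-update i at (λ j j≢i → off (fsuc j) (j≢i ∘ fsuc-injective))))
        (sym (+-assoc (f fzero) _ _))

-- The algorithm

received : Port → List Port → ℕ
received q []      = 0
received q (p ∷ h) = if samePort p q then suc (received q h) else received q h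

-- A clockwise pulse arrives on port 0.
cw ccw : List Port → ℕ
cw  = received port0
ccw = received port1

Balanced : ℕ → List Port → Set
Balanced v h = cw h ≡ v × ccw h ≡ v

-- Candidacy is never lost: the extra pulse it has caused cannot be unsent.
Candidate : ℕ → List Port → Set
Candidate v []      = Balanced v []
Candidate v (p ∷ h) = Balanced v (p ∷ h) ⊎ Candidate v h

balanced? : ∀ v h → Dec (Balanced v h)
balanced? v h = (cw h ≟ v) ×-dec (ccw h ≟ v)

candidate? : ∀ v h → Dec (Candidate v h)
candidate? v []      = balanced? v []
candidate? v (p ∷ h) = balanced? v (p ∷ h) ⊎-dec candidate? v h

balanced⇒candidate : ∀ {v} h → Balanced v h → Candidate v h
balanced⇒candidate []      bal = bal
balanced⇒candidate (p ∷ h) bal = inj₁ bal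

-- A started node that is ahead has sent one counterclockwise pulse more than it has received.
-- Reaching count `v` ends this by absorption, except for a candidate, whose extra pulse keeps it
-- ahead until count `v + 1`.
Ahead : ℕ → List Port → Set
Ahead v h = ccw h < v ⊎ (Candidate v h × ccw h ≡ v)

ahead? : ∀ v h → Dec (Ahead v h)
ahead? v h = (ccw h <? v) ⊎-dec (candidate? v h ×-dec (ccw h ≟ v))

-- Total number of pulses sent, indexed by the port they arrive on at the
-- neighbour; thus port0 stands for the pulses sent out of port 1.
emitted : Port → ℕ → List Port → ℕ
emitted port0 v h = if does (cw h <? v) then suc (cw h) else cw h
emitted port1 v h = if does (v ≤? cw h)
                    then (if does (ahead? v h) then suc (ccw h) else ccw h)
                    else 0

Finished : ℕ → List Port → Set
Finished v h = v ≤ cw h × cw h < ccw h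

finished? : ∀ v h → Dec (Finished v h)
finished? v h = (v ≤? cw h) ×-dec (cw h <? ccw h)

decide : ℕ → List Port → Maybe Output
decide v h = if does (finished? v h)
             then just (if does (cw h ≟ v) then Leader else NonLeader)
             else nothing

elect : Algorithm
elect .start v = record
  { send₀ = emitted port1 v [] ; send₁ = emitted port0 v [] ; decision = decide v [] }
-- A default value: a history under processing contains the current pulse, so it is never empty.
elect .onPulse v [] = elect .start v
elect .onPulse v (p ∷ h) = record
  -- The truncated differences are exact because the totals never decrease, by `emitted-mono`.
  { send₀ = emitted port1 v (p ∷ h) ∸ emitted port1 v h
  ; send₁ = emitted port0 v (p ∷ h) ∸ emitted port0 v h
  ; decision = decide v (p ∷ h) }

-- Case views of the totals sent, and their bounds

data EmittedCw (v : ℕ) (h : List Port) : ℕ → Set where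
  before : cw h < v → EmittedCw v h (suc (cw h))
  after  : v ≤ cw h → EmittedCw v h (cw h)

emittedCw : ∀ v h → EmittedCw v h (emitted port0 v h)
emittedCw v h with cw h <? v
... | yes lt rewrite dec-true (cw h <? v) lt  = before lt
... | no ¬lt rewrite dec-false (cw h <? v) ¬lt = after (≮⇒≥ ¬lt)

data EmittedCcw (v : ℕ) (h : List Port) : ℕ → Set where
  waiting : cw h < v → EmittedCcw v h 0
  ahead   : v ≤ cw h → Ahead v h → EmittedCcw v h (suc (ccw h))
  level   : v ≤ cw h → ¬ Ahead v h → EmittedCcw v h (ccw h)

emittedCcw : ∀ v h → EmittedCcw v h (emitted port1 v h)
emittedCcw v h with v ≤? cw h
... | no ¬le rewrite dec-false (v ≤? cw h) ¬le = waiting (≰⇒> ¬le)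
... | yes le rewrite dec-true (v ≤? cw h) le with ahead? v h
...   | yes ah rewrite dec-true (ahead? v h) ah  = ahead le ah
...   | no ¬ah rewrite dec-false (ahead? v h) ¬ah = level le ¬ah

emitted-mono : ∀ q v p h → emitted q v h ≤ emitted q v (p ∷ h)
emitted-mono port0 v port0 h
  with emitted port0 v h | emittedCw v h | emitted port0 v (port0 ∷ h) | emittedCw v (port0 ∷ h)
... | _ | before _ | _ | before _ = n≤1+n _
... | _ | before _ | _ | after _  = ≤-refl
... | _ | after _  | _ | before _ = m≤n+m _ 2
... | _ | after _  | _ | after _  = n≤1+n _
emitted-mono port0 v port1 h = ≤-refl
emitted-mono port1 v port0 h
  with emitted port1 v h | emittedCcw v h | emitted port1 v (port0 ∷ h) | emittedCcw v (port0 ∷ h)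
... | _ | waiting _ | _ | _ = z≤n
... | _ | ahead le _  | _ | waiting gt  = contradiction (m≤n⇒m≤1+n le) (<⇒≱ gt)
... | _ | ahead _ _   | _ | ahead _ _   = ≤-refl
... | _ | ahead _ (inj₁ lt)       | _ | level _ ¬ah = contradiction (inj₁ lt) ¬ah
-- A clockwise pulse may destroy the balance, but candidacy persists along the history, so the extra
-- pulse stays counted.
... | _ | ahead _ (inj₂ (ca , eq)) | _ | level _ ¬ah = contradiction (inj₂ (inj₂ ca , eq)) ¬ah
... | _ | level le _  | _ | waiting gt  = contradiction (m≤n⇒m≤1+n le) (<⇒≱ gt)
... | _ | level _ _   | _ | ahead _ _   = n≤1+n _
... | _ | level _ _   | _ | level _ _   = ≤-refl
emitted-mono port1 v port1 h
  with emitted port1 v h | emittedCcw v h | emitted port1 v (port1 ∷ h) | emittedCcw v (port1 ∷ h)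
... | _ | waiting _  | _ | _ = z≤n
... | _ | ahead le _ | _ | waiting gt = contradiction le (<⇒≱ gt)
... | _ | ahead _ _  | _ | ahead _ _  = n≤1+n _
... | _ | ahead _ _  | _ | level _ _  = ≤-refl
... | _ | level le _ | _ | waiting gt = contradiction le (<⇒≱ gt)
... | _ | level _ _  | _ | ahead _ _  = m≤n+m _ 2
... | _ | level _ _  | _ | level _ _  = n≤1+n _

-- These are also the final counts in each direction; the additional one is the extra pulse of the
-- winner. Their sum `2 * M + 1` is the bound on the pulses sent per node.
cap : Port → ℕ → ℕ
cap port0 M = M
cap port1 M = suc M

-- This passes the bound from a node to the neighbour that it feeds: a surplus over the received
-- count exists only while that count is below `v`, or equals `v` at a counterclockwise candidate.
emitted≤cap : ∀ q {v h M} → v ≤ M → received q h ≤ cap q M → emitted q v h ≤ cap q M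
emitted≤cap port0 {v} {h} v≤M r≤ with emitted port0 v h | emittedCw v h
... | _ | before lt = ≤-trans lt v≤M
... | _ | after _   = r≤
emitted≤cap port1 {v} {h} v≤M r≤ with emitted port1 v h | emittedCcw v h
... | _ | waiting _ = z≤n
... | _ | ahead _ (inj₁ lt)       = s≤s (≤-trans (<⇒≤ lt) v≤M)
... | _ | ahead _ (inj₂ (_ , eq)) = s≤s (≤-trans (≤-reflexive eq) v≤M)
... | _ | level _ _ = r≤

received≤emittedCw : ∀ v h → cw h ≤ emitted port0 v h
received≤emittedCw v h with emitted port0 v h | emittedCw v h
... | _ | before _ = n≤1+n _
... | _ | after _  = ≤-refl

received≤emittedCcw : ∀ {v} h → v ≤ cw h → ccw h ≤ emitted port1 v h
received≤emittedCcw {v} h le with emitted port1 v h | emittedCcw v h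
... | _ | waiting gt = contradiction le (<⇒≱ gt)
... | _ | ahead _ _  = n≤1+n _
... | _ | level _ _  = ≤-refl

emittedCw≤cw : ∀ {v} h → v ≤ cw h → emitted port0 v h ≤ cw h
emittedCw≤cw {v} h le with emitted port0 v h | emittedCw v h
... | _ | before lt = contradiction le (<⇒≱ lt)
... | _ | after _   = ≤-refl

emittedCw≤cw⇒started : ∀ {v} h → emitted port0 v h ≤ cw h → v ≤ cw h
emittedCw≤cw⇒started {v} h e with emitted port0 v h | emittedCw v h
... | _ | before _ = contradiction e 1+n≰n
... | _ | after le = le

emittedCcw≤ccw⇒¬ahead : ∀ {v} h → v ≤ cw h → emitted port1 v h ≤ ccw h → ¬ Ahead v h
emittedCcw≤ccw⇒¬ahead {v} h le e with emitted port1 v h | emittedCcw v h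
... | _ | waiting gt  = contradiction le (<⇒≱ gt)
... | _ | ahead _ _   = contradiction e 1+n≰n
... | _ | level _ ¬ah = ¬ah

decide-just⇒finished : ∀ v h {o} → decide v h ≡ just o → Finished v h
decide-just⇒finished v h eq with finished? v h
... | yes fin = fin
... | no ¬fin rewrite dec-false (finished? v h) ¬fin = contradiction eq λ ()

decide-leader : ∀ {v} h → Finished v h → cw h ≡ v → decide v h ≡ just Leader
decide-leader {v} h fin eq
  rewrite dec-true (finished? v h) fin | dec-true (cw h ≟ v) eq = refl

decide-nonleader : ∀ {v} h → Finished v h → cw h ≢ v → decide v h ≡ just NonLeader
decide-nonleader {v} h fin neq
  rewrite dec-true (finished? v h) fin | dec-false (cw h ≟ v) neq = refl

-- Here `q` is the arrival port and thus names a direction of travel, so that both directions share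
-- one treatment. A pulse arriving on port 0 left through port 1, hence the crossing in `fresh`.
source target : ∀ {m} → Port → Fin (suc m) → Fin (suc m)
source port0 = prev
source port1 = next
target port0 = next
target port1 = prev

source-target : ∀ {m} q (i : Fin (suc m)) → source q (target q i) ≡ i
source-target port0 = prev-next
source-target port1 = next-prev

target-source : ∀ {m} q (i : Fin (suc m)) → target q (source q i) ≡ i
target-source port0 = next-prev
target-source port1 = prev-next

fresh : Port → Action → ℕ
fresh port0 = send₁
fresh port1 = send₀

module Ring (m : ℕ) (ID : Fin (suc m) → ℕ) (ID-inj : Injective _≡_ _≡_ ID) where

  open Execution elect m ID

  M : ℕ
  M = maxF ID

  ID≤M : ∀ i → ID i ≤ M
  ID≤M = f≤maxF ID

  top : Node
  top = proj₁ (maxF-attained ID)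

  ID-top : ID top ≡ M
  ID-top = proj₂ (maxF-attained ID)

  Histories : Set
  Histories = Node → List Port

  -- Counting arguments on one snapshot of histories

  module Counts (H : Histories) where

    cwAt ccwAt : Node → ℕ
    cwAt  = cw ∘ H
    ccwAt = ccw ∘ H

    CandidateAt : Node → Set
    CandidateAt i = Candidate (ID i) (H i)

    -- This is channel conservation with the pulses in transit forgotten; no order of events enters
    -- the counting arguments.
    Causal : Set
    Causal = ∀ q i → received q (H i) ≤ emitted q (ID (source q i)) (H (source q i))

    Bounded : Set
    Bounded = ∀ q i → received q (H i) ≤ cap q M

    Descending : Set
    Descending = ∀ i → CandidateAt i →
      ID i ≡ M ⊎ ID i ≡ 0 ⊎ (CandidateAt (next i) × ID i ≡ suc (ID (next i)))

    -- The run that starts at `i` passes through every ID from `k` down to 0. As IDs are unique, it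
    -- contains all nodes with an ID of at most `k`.
    candidate-below : Descending → ∀ k {i} → ID i ≡ k → k < M → CandidateAt i →
                      ∀ j → ID j ≤ k → CandidateAt j
    candidate-below desc k {i} i≡k k<M ca j j≤k with ID j ≟ ID i
    ... | yes eq = subst CandidateAt (sym (ID-inj eq)) ca
    ... | no j≢i with desc i ca
    candidate-below desc k i≡k k<M ca j j≤k | no j≢i | inj₁ i≡M =
      contradiction (trans (sym i≡k) i≡M) (<⇒≢ k<M)
    candidate-below desc zero i≡0 k<M ca j j≤0 | no j≢i | _ =
      contradiction (trans (n≤0⇒n≡0 j≤0) (sym i≡0)) j≢i
    candidate-below desc (suc k) i≡1+k k<M ca j j≤k | no j≢i | inj₂ (inj₁ i≡0) =
      contradiction (trans (sym i≡1+k) i≡0) λ ()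
    candidate-below desc (suc k) i≡1+k k<M ca j j≤k | no j≢i | inj₂ (inj₂ (ca′ , i≡1+n)) =
      candidate-below desc k (suc-injective (trans (sym i≡1+n) i≡1+k)) (<⇒≤ k<M) ca′ j
        (≤-pred (≤∧≢⇒< j≤k (λ j≡ → j≢i (trans j≡ (sym i≡1+k)))))

    -- If the node behind a misled candidate had a smaller ID, it would be the
    -- end of the candidate's own run, which would then be the whole ring.
    behind-candidate : Descending → ∀ i → CandidateAt (next i) →
                       ID i ≤ ID (next i) → ID (next i) ≡ M
    behind-candidate desc i ca i≤n with ID (next i) ≟ M
    ... | yes eq = eq
    ... | no n≢M = contradiction n<M (≤⇒≯ M≤n)
      where
      n<M : ID (next i) < M
      n<M = ≤∧≢⇒< (ID≤M (next i)) n≢M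

      descent : ∀ j → ID j ≤ ID (next i) →
                ID j ≡ 0 ⊎ (CandidateAt (next j) × ID j ≡ suc (ID (next j)))
      descent j j≤n with desc j (candidate-below desc _ refl n<M ca j j≤n)
      ... | inj₁ j≡M = contradiction (≤-trans (≤-reflexive (sym j≡M)) j≤n) (<⇒≱ n<M)
      ... | inj₂ r   = r

      i≡0 : ID i ≡ 0
      i≡0 with descent i i≤n
      ... | inj₁ eq       = eq
      ... | inj₂ (_ , eq) = contradiction (≤-trans (≤-reflexive (sym eq)) i≤n) 1+n≰n

      closed : ∀ j → ID j ≤ ID (next i) → ID (next j) ≤ ID (next i)
      closed j j≤n with descent j j≤n
      -- A node of ID 0 is `i` itself, so the descent wraps round to `next i`.
      ... | inj₁ j≡0      = ≤-reflexive (cong (ID ∘ next) (ID-inj (trans j≡0 (sym i≡0))))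
      ... | inj₂ (_ , eq) = ≤-trans (n≤1+n _) (≤-trans (≤-reflexive (sym eq)) j≤n)

      M≤n : M ≤ ID (next i)
      M≤n = subst (_≤ ID (next i)) ID-top
              (next-closed (λ j → ID j ≤ ID (next i)) closed {next i} ≤-refl top)

    record Within (A B : ℕ) (i : Node) : Set where
      constructor within
      field
        cw≤     : cwAt i ≤ A
        ≤ccw    : B ≤ ccwAt i
        started : ID i ≤ cwAt i
    open Within

    -- The counterclockwise count drops below `B` only at a node that is ahead. In `lagging` its
    -- count is still below its ID; in `misled` the surplus is the extra pulse of a candidate, which
    -- may also be `top`.
    data Obstacle (A B : ℕ) (i : Node) : Set where
      lagging : B ≤ ID i → ID i ≤ A → ccwAt i < B → Obstacle A B i
      misled  : CandidateAt i → ID i ≤ A → ccwAt i ≡ ID i → B ≡ suc (ID i) → Obstacle A B i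

    causal-next : Causal → ∀ i → cwAt (next i) ≤ emitted port0 (ID i) (H i)
    causal-next causal i =
      subst (λ j → cwAt (next i) ≤ emitted port0 (ID j) (H j)) (prev-next i) (causal port0 (next i))

    -- The `B` pulses received by `i` were sent by `next i`, which must be started since `1 ≤ B` and
    -- a waiting node has sent none. In return `i`, being started, has passed on at most `A`
    -- clockwise pulses.
    advance : Causal → ∀ {A B} → 1 ≤ B → ∀ i → Within A B i →
              Within A B (next i) ⊎ Obstacle A B (next i)
    advance causal {A} {B} 1≤B i (within a≤A B≤b v≤a) =
      by-case (emittedCcw (ID (next i)) (H (next i))) (≤-trans B≤b (causal port1 i))
      where
      a′≤A : cwAt (next i) ≤ A
      a′≤A = ≤-trans (causal-next causal i) (≤-trans (emittedCw≤cw (H i) v≤a) a≤A)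
      by-case : ∀ {s} → EmittedCcw (ID (next i)) (H (next i)) s → B ≤ s →
             Within A B (next i) ⊎ Obstacle A B (next i)
      by-case (waiting _) B≤0 = contradiction (≤-trans 1≤B B≤0) λ ()
      by-case (level le _) B≤b′ = inj₁ (within a′≤A B≤b′ le)
      by-case (ahead le ah) B≤1+b′ with B ≤? ccwAt (next i) | ah
      ... | yes B≤b′ | _ = inj₁ (within a′≤A B≤b′ le)
      ... | no B≰b′ | inj₁ b′<v =
            inj₂ (lagging (≤-trans B≤1+b′ b′<v) (≤-trans le a′≤A) (≰⇒> B≰b′))
      ... | no B≰b′ | inj₂ (ca , b′≡v) =
            inj₂ (misled ca (≤-trans le a′≤A) b′≡v
                   (trans (≤-antisym B≤1+b′ (≰⇒> B≰b′)) (cong suc b′≡v)))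

    go-round : Causal → ∀ {A B} → 1 ≤ B → ∀ i → Within A B i →
               M ≤ A ⊎ ∃ λ j → Within A B j × Obstacle A B (next j)
    go-round causal {A} {B} 1≤B i wi
      with next-closed (λ j → Within A B j ⊎ ∃ λ k → Within A B k × Obstacle A B (next k))
                       closed (inj₁ wi) top
      where
      closed : ∀ j → Within A B j ⊎ (∃ λ k → Within A B k × Obstacle A B (next k)) →
               Within A B (next j) ⊎ (∃ λ k → Within A B k × Obstacle A B (next k))
      closed j (inj₂ found) = inj₂ found
      closed j (inj₁ wj) with advance causal 1≤B j wj
      ... | inj₁ wn = inj₁ wn
      ... | inj₂ ob = inj₂ (j , wj , ob)
    ... | inj₁ wt    = inj₁ (≤-trans (≤-reflexive (sym ID-top)) (≤-trans (started wt) (cw≤ wt)))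
    ... | inj₂ found = inj₂ found

    -- No node stops early. The round is taken with its own two counts as `A < B`, so a lagging node
    -- is impossible: it would give `B ≤ A`.
    finished⇒final : Causal → Bounded → Descending → ∀ i → Finished (ID i) (H i) →
                     cwAt i ≡ M × ccwAt i ≡ suc M
    finished⇒final causal bounded desc i (v≤a , a<b) =
      a≡M , ≤-antisym (bounded port1 i) (≤-trans (s≤s (≤-reflexive (sym a≡M))) a<b)
      where
      M≤a : M ≤ cwAt i
      M≤a with go-round causal (≤-trans (s≤s z≤n) a<b) i (within ≤-refl ≤-refl v≤a)
      ... | inj₁ M≤a = M≤a
      ... | inj₂ (j , _ , lagging b≤v v≤a _) =
            contradiction (≤-trans a<b (≤-trans b≤v v≤a)) 1+n≰n
      -- Here `A ≤ ID (next j)`, while the started node `j` has an ID of at most `A`. So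
      -- `behind-candidate` applies and the candidate is the node of ID `M`.
      ... | inj₂ (j , wj , misled ca v≤a _ b≡1+v) =
            ≤-trans (≤-reflexive (sym (behind-candidate desc j ca j≤n))) v≤a
            where
            j≤n : ID j ≤ ID (next j)
            j≤n = ≤-trans (started wj) (≤-trans (cw≤ wj) (≤-pred (≤-trans a<b (≤-reflexive b≡1+v))))
      a≡M : cwAt i ≡ M
      a≡M = ≤-antisym (bounded port0 i) M≤a

    -- This traces a new candidate to its cause, by a round with `A` and `B` both equal to its ID.
    -- It does without `Descending`, which has yet to be re-established at that moment.
    balanced-round : Causal → ∀ i → Balanced (ID i) (H i) → ID i ≡ M ⊎ ID i ≡ 0 ⊎
      ∃ λ j → ID j ≤ ID i × CandidateAt (next j) × next j ≢ i × ID i ≡ suc (ID (next j))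
    balanced-round causal i (a≡v , b≡v) with ID i ≟ 0
    ... | yes v≡0 = inj₂ (inj₁ v≡0)
    ... | no v≢0 with go-round causal (n≢0⇒n>0 v≢0) i
                        (within (≤-reflexive a≡v) (≤-reflexive (sym b≡v)) (≤-reflexive (sym a≡v)))
    ...   | inj₁ M≤v = inj₁ (≤-antisym (ID≤M i) M≤v)
    ...   | inj₂ (j , _ , lagging v≤n n≤v b<v) =
            -- The bounds pinch the ID of the lagging node to `ID i`, so it is `i` itself, whose
            -- count does not lag.
            contradiction (trans (cong ccwAt (ID-inj (≤-antisym n≤v v≤n))) b≡v) (<⇒≢ b<v)
    ...   | inj₂ (j , wj , misled ca _ _ v≡1+n) =
            inj₂ (inj₂ (j , ≤-trans (started wj) (cw≤ wj) , ca ,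
              (λ { refl → contradiction (sym v≡1+n) 1+n≢n }) , v≡1+n))

    -- With empty channels the counts are monotone around the cycle, hence constant in each
    -- direction. Constant clockwise counts mean that every node is started; constant
    -- counterclockwise counts mean that `top` is not ahead, which pushes its count above `M`.
    quiescent⇒final : Bounded →
      (∀ q i → received q (H i) ≡ emitted q (ID (source q i)) (H (source q i))) →
      ∀ i → cwAt i ≡ M × ccwAt i ≡ suc M
    quiescent⇒final bounded flow i = a≡M i , ≤-antisym (bounded port1 i) (≤-trans M<top (b-const i top))
      where
      flow-next : ∀ j → cwAt (next j) ≡ emitted port0 (ID j) (H j)
      flow-next j = subst (λ k → cwAt (next j) ≡ emitted port0 (ID k) (H k)) (prev-next j) (flow port0 (next j))

      a-const : ∀ j k → cwAt j ≤ cwAt k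
      a-const j k = next-closed (λ k → cwAt j ≤ cwAt k)
        (λ k le → ≤-trans le (≤-trans (received≤emittedCw (ID k) (H k)) (≤-reflexive (sym (flow-next k)))))
        {j} ≤-refl k

      startedAt : ∀ j → ID j ≤ cwAt j
      startedAt j = emittedCw≤cw⇒started (H j)
        (≤-trans (≤-reflexive (sym (flow-next j))) (a-const (next j) j))

      a≡M : ∀ j → cwAt j ≡ M
      a≡M j = ≤-antisym (bounded port0 j)
        (≤-trans (≤-reflexive (sym ID-top)) (≤-trans (startedAt top) (a-const top j)))

      b-const : ∀ j k → ccwAt k ≤ ccwAt j
      b-const j k = next-closed (λ k → ccwAt k ≤ ccwAt j)
        (λ k le → ≤-trans (received≤emittedCcw (H (next k)) (startedAt (next k)))
                          (≤-trans (≤-reflexive (sym (flow port1 k))) le))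
        {j} ≤-refl k

      ¬ahead : ¬ Ahead (ID top) (H top)
      ¬ahead = emittedCcw≤ccw⇒¬ahead (H top) (startedAt top)
        (subst (λ k → emitted port1 (ID k) (H k) ≤ ccwAt top) (next-prev top)
          (≤-trans (≤-reflexive (sym (flow port1 (prev top)))) (b-const top (prev top))))

      M<top : M < ccwAt top
      M<top with <-cmp (ccwAt top) (ID top)
      ... | tri< b<v _ _ = contradiction (inj₁ b<v) ¬ahead
      ... | tri> _ _ v<b = subst (_< ccwAt top) ID-top v<b
      -- At equality `top` would be balanced, hence a candidate with its extra pulse still out.
      ... | tri≈ _ b≡v _ = contradiction
              (inj₂ (balanced⇒candidate (H top) (trans (a≡M top) (sym ID-top) , b≡v) , b≡v)) ¬ahead

  open Counts

  -- How one received pulse affects candidacy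

  module Update (H : Histories) (i : Node) (p : Port) where

    H′ : Histories
    H′ j = if does (j Fin.≟ i) then p ∷ H i else H j

    at : H′ i ≡ p ∷ H i
    at rewrite dec-true (i Fin.≟ i) refl = refl

    off : ∀ {j} → j ≢ i → H′ j ≡ H j
    off {j} j≢i rewrite dec-false (j Fin.≟ i) j≢i = refl

    candidate⁺ : ∀ j → CandidateAt H j → CandidateAt H′ j
    candidate⁺ j ca with j Fin.≟ i
    ... | yes refl = inj₂ ca
    ... | no _     = ca

    -- Only the receiver `i` can become a candidate. The round that explains this uses the new
    -- counts, whereas the run it meets obeys the old `Descending`.
    descending⁺ : Causal H′ → Descending H → Descending H′
    descending⁺ causal desc j ca = by-case (j Fin.≟ i)
      where
      Goal : Node → Set
      Goal j = ID j ≡ M ⊎ ID j ≡ 0 ⊎ (CandidateAt H′ (next j) × ID j ≡ suc (ID (next j)))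

      old : ∀ j → CandidateAt H j → Goal j
      old j ca with desc j ca
      ... | inj₁ eq = inj₁ eq
      ... | inj₂ (inj₁ eq) = inj₂ (inj₁ eq)
      ... | inj₂ (inj₂ (ca′ , eq)) = inj₂ (inj₂ (candidate⁺ (next j) ca′ , eq))

      new : Balanced (ID i) (H′ i) → Goal i
      new bal with balanced-round H′ causal i bal
      ... | inj₁ eq = inj₁ eq
      ... | inj₂ (inj₁ eq) = inj₂ (inj₁ eq)
      ... | inj₂ (inj₂ (k , k≤i , ca′ , n≢i , i≡1+n)) with ID k ≟ ID i
      ...   | yes k≡i with refl ← ID-inj k≡i = inj₂ (inj₂ (ca′ , i≡1+n))
      -- Since `next k` is not `i`, it was a candidate before this pulse. If `k` were not `i`, its
      -- ID would be at most that of `next k`; then `behind-candidate` gives `next k` the ID `M`,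
      -- and `i` an ID above `M`.
      ...   | no k≢i = contradiction (ID≤M i) (<⇒≱ (≤-reflexive (sym i≡1+M)))
        where
        n≡M : ID (next k) ≡ M
        n≡M = behind-candidate H desc k (subst (Candidate (ID (next k))) (off n≢i) ca′)
                (≤-pred (≤-trans (≤∧≢⇒< k≤i k≢i) (≤-reflexive i≡1+n)))
        i≡1+M : ID i ≡ suc M
        i≡1+M = trans i≡1+n (cong suc n≡M)

      by-case : Dec (j ≡ i) → Goal j
      by-case (no j≢i) = old j (subst (Candidate (ID j)) (off j≢i) ca)
      by-case (yes refl) with subst (Candidate (ID i)) at ca
      ... | inj₁ bal = new (subst (Balanced (ID i)) (sym at) bal)
      ... | inj₂ ca′ = old i ca′

  -- The invariant of reachable configurations

  record Invariant (c : Config m) : Set where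
    field
      flow    : ∀ q j → transit c j q + received q (hist c j)
                        ≡ emitted q (ID (source q j)) (hist c (source q j))
      outputs : ∀ j → out c j ≡ decide (ID j) (hist c j)
      total   : sent c ≡ sumF λ j → emitted port1 (ID j) (hist c j) + emitted port0 (ID j) (hist c j)
      bounded : Bounded (hist c)
      desc    : Descending (hist c)

    causal : Causal (hist c)
    causal q j = ≤-trans (m≤n+m _ _) (≤-reflexive (flow q j))

    in-transit : ∀ q j → transit c j q + received q (hist c j) ≤ cap q M
    in-transit q j = ≤-trans (≤-reflexive (flow q j))
      (emitted≤cap q {h = hist c (source q j)} (ID≤M (source q j)) (bounded q (source q j)))

    just⇒final : ∀ j {o} → out c j ≡ just o → ∀ q → received q (hist c j) ≡ cap q M
    just⇒final j eq q with finished⇒final (hist c) causal bounded desc j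
                             (decide-just⇒finished (ID j) (hist c j) (trans (sym (outputs j)) eq)) | q
    ... | a≡M , _ | port0 = a≡M
    ... | _ , b≡M | port1 = b≡M

    -- A decided node has already received all that `in-transit` allows its channels to carry. This
    -- yields quiescence, and also shows that no pulse is ever delivered to a terminated node.
    just⇒no-transit : ∀ j {o} → out c j ≡ just o → ∀ q → transit c j q ≡ 0
    just⇒no-transit j eq q = n≤0⇒n≡0 (+-cancelʳ-≤ (cap q M) (transit c j q) 0
      (≤-trans (≤-reflexive (cong (transit c j q +_) (sym (just⇒final j eq q)))) (in-transit q j)))

  open Invariant

  invariant-initial : Invariant initial
  invariant-initial = record
    { flow    = λ { port0 j → +-identityʳ _ ; port1 j → +-identityʳ _ }
    ; outputs = λ _ → refl
    ; total   = refl
    ; bounded = λ q i → z≤n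
    -- On the empty history, balance means that the ID is 0.
    ; desc    = λ i (0≡v , _) → inj₂ (inj₁ (sym 0≡v))
    }

  deliver-running : ∀ c i p → out c i ≡ nothing →
    let h = p ∷ hist c i
        a = onPulse elect (ID i) h
    in deliver c i p ≡ record
      { hist    = λ j → if does (j Fin.≟ i) then h else hist c j
      ; out     = λ j → if does (j Fin.≟ i) then decision a else out c j
      ; transit = addSends i a (consume i p (transit c))
      ; sent    = sent c + send₀ a + send₁ a }
  deliver-running c i p eq rewrite eq = refl

  addSends-fresh : ∀ i a t j q →
    addSends i a t j q ≡ t j q + (if does (j Fin.≟ target q i) then fresh q a else 0)
  addSends-fresh i a t j port0 = refl
  addSends-fresh i a t j port1 = refl

  module Step {c : Config m} (inv : Invariant c) (i : Node) (p : Port) (pending : 0 < transit c i p) where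

    open Update (hist c) i p

    private
      v = ID i
      h = hist c i
      a = onPulse elect v (p ∷ h)

    consumed : ∀ q j → consume i p (transit c) j q + received q (H′ j)
                       ≡ transit c j q + received q (hist c j)
    consumed q j with j Fin.≟ i
    ... | no _ = refl
    ... | yes refl = by-port p q pending
      where
      by-port : ∀ p q → 0 < transit c i p →
        (if samePort p q then transit c i q ∸ 1 else transit c i q) + received q (p ∷ h)
        ≡ transit c i q + received q h
      by-port port0 port1 _ = refl
      by-port port1 port0 _ = refl
      -- A pending pulse makes the truncated decrement exact.
      by-port port0 port0 0<t with suc t ← transit c i port0 = +-suc t _
      by-port port1 port1 0<t with suc t ← transit c i port1 = +-suc t _

    emitted-new : ∀ q → emitted q v (p ∷ h) ≡ emitted q v h + fresh q a
    emitted-new port0 = sym (m+[n∸m]≡n (emitted-mono port0 v p h))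
    emitted-new port1 = sym (m+[n∸m]≡n (emitted-mono port1 v p h))

    emitted-source : ∀ q j → emitted q (ID (source q j)) (H′ (source q j))
      ≡ emitted q (ID (source q j)) (hist c (source q j))
        + (if does (j Fin.≟ target q i) then fresh q a else 0)
    emitted-source q j with j Fin.≟ target q i
    ... | yes refl rewrite source-target q i = trans (cong (emitted q v) at) (emitted-new q)
    ... | no j≢ = trans (cong (emitted q (ID (source q j))) (off λ { refl → j≢ (sym (target-source q j)) }))
                        (sym (+-identityʳ _))

    flow⁺ : ∀ q j → addSends i a (consume i p (transit c)) j q + received q (H′ j)
                    ≡ emitted q (ID (source q j)) (H′ (source q j))
    flow⁺ q j = begin
      addSends i a t′ j q + received q (H′ j)  ≡⟨ cong (_+ received q (H′ j)) (addSends-fresh i a t′ j q) ⟩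
      t′ j q + x + received q (H′ j)           ≡⟨ xy∙z≈xz∙y (t′ j q) x _ ⟩
      t′ j q + received q (H′ j) + x           ≡⟨ cong (_+ x) (trans (consumed q j) (flow inv q j)) ⟩
      emitted q (ID (source q j)) (hist c (source q j)) + x ≡⟨ emitted-source q j ⟨
      emitted q (ID (source q j)) (H′ (source q j)) ∎
      where
      open ≡-Reasoning
      t′ = consume i p (transit c)
      x  = if does (j Fin.≟ target q i) then fresh q a else 0

    outputs⁺ : ∀ j → (if does (j Fin.≟ i) then decide v (p ∷ h) else out c j) ≡ decide (ID j) (H′ j)
    outputs⁺ j with j Fin.≟ i
    ... | yes refl = refl
    ... | no _     = outputs inv j

    total⁺ : sent c + send₀ a + send₁ a
             ≡ sumF λ j → emitted port1 (ID j) (H′ j) + emitted port0 (ID j) (H′ j)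
    total⁺ = begin
      sent c + send₀ a + send₁ a    ≡⟨ +-assoc (sent c) _ _ ⟩
      sent c + (send₀ a + send₁ a)  ≡⟨ cong (_+ (send₀ a + send₁ a)) (total inv) ⟩
      sumF (λ j → emitted port1 (ID j) (hist c j) + emitted port0 (ID j) (hist c j)) + (send₀ a + send₁ a)
        ≡⟨ sumF-update i at-i (λ j j≢i → cong (λ h → emitted port1 (ID j) h + emitted port0 (ID j) h) (off j≢i)) ⟨
      sumF (λ j → emitted port1 (ID j) (H′ j) + emitted port0 (ID j) (H′ j)) ∎
      where
      open ≡-Reasoning
      at-i : emitted port1 v (H′ i) + emitted port0 v (H′ i)
             ≡ emitted port1 v h + emitted port0 v h + (send₀ a + send₁ a)
      at-i = begin
        emitted port1 v (H′ i) + emitted port0 v (H′ i)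
          ≡⟨ cong (λ h → emitted port1 v h + emitted port0 v h) at ⟩
        emitted port1 v (p ∷ h) + emitted port0 v (p ∷ h)
          ≡⟨ cong₂ _+_ (emitted-new port1) (emitted-new port0) ⟩
        emitted port1 v h + send₀ a + (emitted port0 v h + send₁ a)
          ≡⟨ interchange (emitted port1 v h) (send₀ a) (emitted port0 v h) (send₁ a) ⟩
        emitted port1 v h + emitted port0 v h + (send₀ a + send₁ a) ∎

    bounded⁺ : Bounded H′
    bounded⁺ q j with j Fin.≟ i
    ... | no _ = bounded inv q j
    -- The pulse being received was in transit, so `in-transit` already leaves room for it.
    ... | yes refl = by-port p q (≤-trans (+-monoˡ-≤ (received p h) pending) (in-transit inv p i))
      where
      by-port : ∀ p q → suc (received p h) ≤ cap p M → received q (p ∷ h) ≤ cap q M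
      by-port port0 port0 le = le
      by-port port1 port1 le = le
      by-port port0 port1 _  = bounded inv port1 i
      by-port port1 port0 _  = bounded inv port0 i

    invariant⁺ : Invariant (deliver c i p)
    invariant⁺ = by-output (out c i) refl
      where
      by-output : ∀ o → out c i ≡ o → Invariant (deliver c i p)
      by-output (just o) eq = contradiction (just⇒no-transit inv i eq p) (>⇒≢ pending)
      by-output nothing eq rewrite deliver-running c i p eq = record
        { flow    = flow⁺
        ; outputs = outputs⁺
        ; total   = total⁺
        ; bounded = bounded⁺
        ; desc    = descending⁺ (λ q j → ≤-trans (m≤n+m _ _) (≤-reflexive (flow⁺ q j))) (desc inv)
        }

  -- Complexity, quiescence and election

  reachable⇒invariant : ∀ {c} → Reachable c → Invariant c
  reachable⇒invariant init              = invariant-initial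
  reachable⇒invariant (step r i p 0<t) = Step.invariant⁺ (reachable⇒invariant r) i p 0<t

  sent-bound : ∀ {c} → Invariant c → sent c ≤ suc m * (2 * M + 1)
  sent-bound {c} inv = ≤-trans (≤-reflexive (total inv)) (sumF-≤ λ j →
    ≤-trans (+-mono-≤ (node≤ port1 j) (node≤ port0 j)) (≤-reflexive arith))
    where
    node≤ : ∀ q j → emitted q (ID j) (hist c j) ≤ cap q M
    node≤ q j = emitted≤cap q {h = hist c j} (ID≤M j) (bounded inv q j)
    arith : suc M + M ≡ 2 * M + 1
    arith = trans (+-comm 1 (M + M)) (cong (λ x → M + x + 1) (sym (+-identityʳ M)))

  terminated⇒quiescent : ∀ {c} → Invariant c → AllTerminated c → NoTransit c
  terminated⇒quiescent {c} inv done i q with out c i in eq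
  ... | nothing = contradiction eq (done i)
  ... | just _  = just⇒no-transit inv i eq q

  -- All clockwise counts end at `M`, and by uniqueness `top` alone has that ID.
  quiescent⇒elected : ∀ {c} → Invariant c → NoTransit c → ExactlyOneLeader c
  quiescent⇒elected {c} inv quiet =
    top , trans (outputs inv top) (decide-leader (hist c top) (finished top) (trans (cw≡M top) (sym ID-top)))
        , λ j j≢top → trans (outputs inv j) (decide-nonleader (hist c j) (finished j)
            (λ eq → j≢top (ID-inj (trans (sym eq) (trans (cw≡M j) (sym ID-top))))))
    where
    final : ∀ i → cwAt (hist c) i ≡ M × ccwAt (hist c) i ≡ suc M
    final = quiescent⇒final (hist c) (bounded inv) λ q i →
      trans (cong (_+ received q (hist c i)) (sym (quiet i q))) (flow inv q i)
    cw≡M : ∀ i → cw (hist c i) ≡ M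
    cw≡M = proj₁ ∘ final
    finished : ∀ i → Finished (ID i) (hist c i)
    finished i = ≤-trans (ID≤M i) (≤-reflexive (sym (cw≡M i)))
               , ≤-reflexive (trans (cong suc (cw≡M i)) (sym (proj₂ (final i))))

theorem1p1 : Σ Algorithm QuiescentLEWithComplexity
theorem1p1 = elect , λ m ID ID-inj → let open Ring m ID ID-inj in
    (λ c r → sent-bound (reachable⇒invariant r))
  , (λ c r → terminated⇒quiescent (reachable⇒invariant r))
  , (λ c r → quiescent⇒elected (reachable⇒invariant r))
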